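{- Let $p$ be an odd prime, let $\alpha \ge \beta$ be positive integers, let $A=\{a\in\mathbb{N} : 1\le a\le p^{\alpha},\ \gcd(a,p)=1\}$, and let $S$ be a sequence over the group $\mathbb{Z}_{p^\alpha}\oplus\mathbb{Z}_{p^\beta}$ with $|S| = \alpha + \beta$. If $S$ has no $A$-weighted zero-sum subsequence of length $n$ for any $1\le n\leq p^{\alpha}$, then $\delta_j(S) \ge 1$ for all $j \in \{1,\dots,\alpha\}$, and $\sum_{j=1}^{\alpha} \delta_j(S) = \alpha + \beta$.
   Context: $\mathbb{Z}_n$ denotes the cyclic group $\mathbb{Z}/n\mathbb{Z}$. A sequence over a finite abelian group $G$ (written additively) is a finite list of elements of $G$, repetitions allowed, order irrelevant; $|S|$ denotes the length (number of terms) of $S$, and a subsequence is obtained by choosing a subset of the indices. A sequence $x_1\cdots x_k$ over $G$ is an $A$-weighted zero-sum sequence of length $k$ if there exist $u_1,\dots,u_k\in A$ (not necessarily distinct) with $u_1x_1+\cdots+u_kx_k=0$ in $G$. For a sequence $S$ over $\mathbb{Z}_{p^\alpha}\oplus\mathbb{Z}_{p^\beta}$, $\delta_j(S)$ denotes the number of terms of $S$, counted with multiplicity, whose order in the group is $p^j$. -}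

module Defs where

open import Level using (_⊔_; 0ℓ)
open import Algebra.Bundles using (AbelianGroup)
import Algebra.Construct.DirectProduct as DirectProduct
import Algebra.Definitions.RawMonoid as RawMonoidDefs
open import Data.Integer.Base as ℤ using (ℤ; +_; 0ℤ)
open import Data.Integer.Divisibility.Signed
  using (_∣_; _∣?_; divides; ∣m∣n⇒∣m+n; ∣m⇒∣-m)
open import Data.Integer.Properties as ℤ using (i≡j⇒i-j≡0)
open import Data.Integer.Tactic.RingSolver using (solve-∀)
open import Data.List.Base using (List; length; lookup; filter; map; upTo)
open import Data.List.Relation.Binary.Sublist.Propositional using (_⊆_)
open import Data.Nat.Base as ℕ using (ℕ; suc; _^_; _≤_; _<_)
open import Data.Nat.GCD using (gcd)
open import Data.Nat.ListAction using () renaming (sum to sumℕ)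
open import Data.Nat.Properties using (_<?_; allUpTo?; ≮⇒≥; <⇒≱)
open import Data.Product.Base using (_×_; _,_; ∃-syntax; Σ-syntax)
open import Data.Product.Relation.Binary.Pointwise.NonDependent
  using (×-decidable)
open import Data.Vec.Functional using (Vector)
open import Relation.Binary.Core using (Rel)
open import Relation.Binary.Definitions using (Decidable)
open import Relation.Binary.PropositionalEquality.Core
  using (_≡_; refl; subst)
open import Relation.Nullary.Decidable
  using (Dec; map′; ¬?; _×-dec_)
open import Relation.Unary using (Pred)

module _ (n : ℕ) where

  infix 4 _≡ₙ_ _≡ₙ?_

  _≡ₙ_ : Rel ℤ 0ℓ
  x ≡ₙ y = + n ∣ x ℤ.- y

  _≡ₙ?_ : Decidable _≡ₙ_
  x ≡ₙ? y = + n ∣? x ℤ.- y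

  private
    reflexive : ∀ {x y} → x ≡ y → x ≡ₙ y
    reflexive {x} {y} x≡y = divides 0ℤ (i≡j⇒i-j≡0 x≡y)

    negate-diff : ∀ x y → ℤ.- (x ℤ.- y) ≡ y ℤ.- x
    negate-diff = solve-∀

    add-diff : ∀ x y z → (x ℤ.- y) ℤ.+ (y ℤ.- z) ≡ x ℤ.- z
    add-diff = solve-∀

    diff-add : ∀ x y u v →
               (x ℤ.- y) ℤ.+ (u ℤ.- v) ≡ (x ℤ.+ u) ℤ.- (y ℤ.+ v)
    diff-add = solve-∀

    diff-negate : ∀ x y → ℤ.- (x ℤ.- y) ≡ ℤ.- x ℤ.- ℤ.- y
    diff-negate = solve-∀

  -- ℤ/nℤ as the setoid of integers under congruence modulo n.
  ℤ/ : AbelianGroup 0ℓ 0ℓ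
  ℤ/ = record
    { Carrier = ℤ
    ; _≈_     = _≡ₙ_
    ; _∙_     = ℤ._+_
    ; ε       = 0ℤ
    ; _⁻¹     = ℤ.-_
    ; isAbelianGroup = record
      { isGroup = record
        { isMonoid = record
          { isSemigroup = record
            { isMagma = record
              { isEquivalence = record
                { refl  = λ {x} → reflexive {x} refl
                ; sym   = λ {x} {y} p →
                    subst (+ n ∣_) (negate-diff x y) (∣m⇒∣-m p)
                ; trans = λ {x} {y} {z} p q →
                    subst (+ n ∣_) (add-diff x y z) (∣m∣n⇒∣m+n p q)
                }
              ; ∙-cong = λ {x} {y} {u} {v} p q →
                  subst (+ n ∣_) (diff-add x y u v) (∣m∣n⇒∣m+n p q)
              }
            ; assoc = λ x y z → reflexive (ℤ.+-assoc x y z)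
            }
          ; identity = (λ x → reflexive (ℤ.+-identityˡ x))
                     , (λ x → reflexive (ℤ.+-identityʳ x))
          }
        ; inverse = (λ x → reflexive (ℤ.+-inverseˡ x))
                  , (λ x → reflexive (ℤ.+-inverseʳ x))
        ; ⁻¹-cong = λ {x} {y} p →
            subst (+ n ∣_) (diff-negate x y) (∣m⇒∣-m p)
        }
      ; comm = λ x y → reflexive (ℤ.+-comm x y)
      }
    }

-- Sequences over G are lists of terms; every notion below is invariant under
-- permuting the list and under replacing terms by ≈-equal ones.
module Sequences {c ℓ} (G : AbelianGroup c ℓ) where

  open AbelianGroup G using (Carrier; _≈_; ε; rawMonoid)
  open RawMonoidDefs rawMonoid using (sum) renaming (_×_ to _·_)

  IsWeightedZeroSum : ∀ {a} → Pred ℕ a → List Carrier → Set (a ⊔ ℓ)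
  IsWeightedZeroSum A T =
    Σ[ u ∈ Vector ℕ (length T) ] (∀ i → A (u i)) ×
                                 sum (λ i → u i · lookup T i) ≈ ε

  HasWeightedZeroSumSubsequence :
    ∀ {a} → Pred ℕ a → List Carrier → ℕ → Set (a ⊔ c ⊔ ℓ)
  HasWeightedZeroSumSubsequence A S n =
    ∃[ T ] T ⊆ S × length T ≡ n × IsWeightedZeroSum A T

  HasOrder : Carrier → ℕ → Set ℓ
  HasOrder x m =
    0 < m × m · x ≈ ε × (∀ k → 0 < k → k · x ≈ ε → m ≤ k)

  module _ (_≈?_ : Decidable _≈_) where

    hasOrder? : Decidable HasOrder
    hasOrder? x m = 0 <? m ×-dec (m · x) ≈? ε ×-dec minimal?
      where
      minimal? : Dec (∀ k → 0 < k → k · x ≈ ε → m ≤ k)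
      minimal? = map′
        (λ f k 0<k kx≈ε → ≮⇒≥ λ k<m → f k<m (0<k , kx≈ε))
        (λ g {k} k<m (0<k , kx≈ε) → <⇒≱ k<m (g k 0<k kx≈ε))
        (allUpTo? (λ k → ¬? (0 <? k ×-dec (k · x) ≈? ε)) m)

    countOfOrder : ℕ → List Carrier → ℕ
    countOfOrder m S = length (filter (λ x → hasOrder? x m) S)

ℤ/_⊕ℤ/_ : ℕ → ℕ → AbelianGroup 0ℓ 0ℓ
ℤ/ m ⊕ℤ/ n = DirectProduct.abelianGroup (ℤ/ m) (ℤ/ n)

SequenceOver : ∀ {c ℓ} → AbelianGroup c ℓ → Set c
SequenceOver G = List (AbelianGroup.Carrier G)

δ : (p α β j : ℕ) → SequenceOver (ℤ/ (p ^ α) ⊕ℤ/ (p ^ β)) → ℕ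
δ p α β j = countOfOrder (×-decidable (_≡ₙ?_ (p ^ α)) (_≡ₙ?_ (p ^ β))) (p ^ j)
  where open Sequences (ℤ/ (p ^ α) ⊕ℤ/ (p ^ β))

Weights : (p α : ℕ) → Pred ℕ 0ℓ
Weights p α a = 1 ≤ a × a ≤ p ^ α × gcd a p ≡ 1

Σ[1≤j≤_]_ : ℕ → (ℕ → ℕ) → ℕ
Σ[1≤j≤ n ] f = sumℕ (map (λ i → f (suc i)) (upTo n))

module Submission where

{-
Present ℤ/p^α ⊕ ℤ/p^β as ℤ²/K.  Lift the terms of S to vectors of ℤ², and call an integer a unit
when it is prime to p.  No nonempty combination of terms with unit coefficients lies in K, since
α + β ≤ p^α.  Cramer's rule now restricts the terms modulo p.  Three terms in pairwise distinct
directions satisfy a relation whose coefficients are the (unit) determinants; so do two pairs of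
parallel terms in distinct directions, by adding the Cramer relations of two triples among them;
and a vector of K outside pℤ² may serve as one member of a triple.  Hence all terms but at most one
lie on a line modulo p, that is, in a lattice Λ of index p, which may be chosen to contain K.

Replacing ℤ² by Λ divides the index p^s of K by p, so by induction there are at most s terms.
Suppose there are exactly s.  Then just one term x is off Λ at each step.  If p^j does not kill
ℤ²/K, then either p^j does not kill Λ/K, and induction gives a term of order p^(j+1) in Λ, or
p^j kills Λ/K.  In the latter case p^(j+1) x ∈ K because p x ∈ Λ, while p^j x ∉ K because x and Λ
generate ℤ² up to units, so x has order p^(j+1).
-}

open import Defs
open import Algebra.Bundles using (AbelianGroup)
import Algebra.Definitions.RawMonoid as RawMonoidDefs
open import Data.Fin.Base using (zero; suc)
open import Data.Integer.Base as ℤ using (ℤ; +_; 0ℤ; 1ℤ; ∣_∣; _*_)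
  renaming (_+_ to _+ᶻ_; _-_ to _-ᶻ_)
open import Data.Integer.Divisibility.Signed
  using (divides; ∣⇒∣ᵤ; ∣ᵤ⇒∣; _∣?_; ∣-trans; ∣m∣n⇒∣m+n; ∣m+n∣n⇒∣m; ∣m∣n⇒∣m-n;
         ∣m⇒∣m*n; ∣n⇒∣m*n; ∣m⇒∣-m; *-monoˡ-∣; *-cancelʳ-∣)
  renaming (_∣_ to _∣ᶻ_)
open import Data.Integer.DivMod using (_%ℕ_; _/ℕ_; n%ℕd<d; a≡a%ℕn+[a/ℕn]*n)
import Data.Integer.Properties as ℤ
open import Data.Integer.Tactic.RingSolver using (solve-∀)
open import Data.List.Base using (List; []; _∷_; length; lookup; map; filter; upTo)
open import Data.List.Membership.Propositional using (_∈_)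
open import Data.List.Membership.Propositional.Properties using (∈-filter⁺; ∈-length; ∈-upTo⁺)
open import Data.List.Properties
  using (map-cong; length-++; filter-++; filter-accept; filter-reject)
open import Data.List.Relation.Binary.Permutation.Propositional
  using (_↭_; refl; prep; swap; ↭-sym)
  renaming (trans to ↭-trans)
open import Data.List.Relation.Binary.Permutation.Propositional.Properties
  using (All-resp-↭; ∈-resp-↭; ↭-length)
open import Data.List.Relation.Binary.Sublist.Propositional using (_⊆_; []; _∷_; _∷ʳ_)
open import Data.List.Relation.Binary.Sublist.Heterogeneous.Properties using (length-mono-≤)
open import Data.List.Relation.Unary.All as All using (All; []; _∷_)
open import Data.List.Relation.Unary.AllPairs using ([]; _∷_)
open import Data.List.Relation.Unary.Any using (here; there)
open import Data.List.Relation.Unary.Unique.Propositional using (Unique)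
open import Data.List.Relation.Unary.Unique.Propositional.Properties using (upTo⁺)
open import Data.Nat.Base as ℕ using (ℕ; zero; suc; _+_; _^_; _≤_; _<_; z≤n; s≤s)
open import Data.Nat.Coprimality using (Coprime; coprime⇒gcd≡1)
open import Data.Nat.Divisibility as ℕ using (_∤_; _∣0)
open import Data.Nat.ListAction using () renaming (sum to sumℕ)
open import Data.Nat.Primality
  using (Prime; euclidsLemma; prime⇒nonZero; prime⇒nonTrivial; prime⇒irreducible)
import Data.Nat.Properties as ℕ
import Data.Nat.Tactic.RingSolver as ℕSolver
open import Data.Product.Base using (_×_; _,_; proj₁; proj₂; ∃-syntax; Σ-syntax; ∃₂)
open import Data.Product.Relation.Binary.Pointwise.NonDependent using (×-decidable)
open import Data.Sum.Base using (_⊎_; inj₁; inj₂; [_,_]′)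
open import Data.Vec.Functional as Vec using (Vector)
open import Function.Base using (_∘_)
open import Level using (0ℓ)
open import Relation.Binary.Definitions using (tri<; tri≈; tri>) renaming (Decidable to Decidable₂)
open import Relation.Binary.PropositionalEquality.Core
  using (_≡_; refl; sym; trans; cong; cong₂; subst; subst₂)
open import Relation.Nullary.Decidable using (Dec; yes; no; _×-dec_)
open import Relation.Nullary.Negation.Core using (¬_; contradiction)
open import Relation.Unary using (Pred; Decidable)

-- Integer vectors in the plane, determinants and Cramer identities.

V : Set
V = ℤ × ℤ

infixl 6 _+ᵥ_
infixr 7 _·_

_+ᵥ_ : V → V → V
(a , b) +ᵥ (c , d) = a +ᶻ c , b +ᶻ d

_·_ : ℤ → V → V
k · (a , b) = k * a , k * b

0ᵥ : V
0ᵥ = 0ℤ , 0ℤ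

det : V → V → ℤ
det (a , b) (c , d) = a * d -ᶻ b * c

+ᵥ-identityʳ : ∀ v → v +ᵥ 0ᵥ ≡ v
+ᵥ-identityʳ (a , b) = cong₂ _,_ (ℤ.+-identityʳ a) (ℤ.+-identityʳ b)

+ᵥ-swap : ∀ u v w → u +ᵥ (v +ᵥ w) ≡ v +ᵥ (u +ᵥ w)
+ᵥ-swap (a , b) (c , d) (e , f) = cong₂ _,_ (eq a c e) (eq b d f)
  where
  eq : ∀ a c e → a +ᶻ (c +ᶻ e) ≡ c +ᶻ (a +ᶻ e)
  eq = solve-∀

·-assoc : ∀ k l v → (k * l) · v ≡ k · l · v
·-assoc k l (a , b) = cong₂ _,_ (ℤ.*-assoc k l a) (ℤ.*-assoc k l b)

·-comm : ∀ k l v → k · l · v ≡ l · k · v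
·-comm k l (a , b) = cong₂ _,_ (eq k l a) (eq k l b)
  where
  eq : ∀ k l a → k * (l * a) ≡ l * (k * a)
  eq = solve-∀

·-distribˡ : ∀ k u v → k · (u +ᵥ v) ≡ k · u +ᵥ k · v
·-distribˡ k (a , b) (c , d) =
  cong₂ _,_ (ℤ.*-distribˡ-+ k a c) (ℤ.*-distribˡ-+ k b d)

·-identityˡ : ∀ v → 1ℤ · v ≡ v
·-identityˡ (a , b) = cong₂ _,_ (ℤ.*-identityˡ a) (ℤ.*-identityˡ b)

det-self : ∀ v → det v v ≡ 0ℤ
det-self (a , b) = eq a b
  where
  eq : ∀ a b → a * b -ᶻ b * a ≡ 0ℤ
  eq = solve-∀

det-antisym : ∀ u v → det v u ≡ ℤ.- det u v
det-antisym (a , b) (c , d) = eq a b c d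
  where
  eq : ∀ a b c d → c * b -ᶻ d * a ≡ ℤ.- (a * d -ᶻ b * c)
  eq = solve-∀

-- The trailing `0ᵥ` reproduces the shape of a `UnitComb` of three terms, so the relation
-- contradicts independence as soon as the three determinants are units.
cramer : ∀ x y z → det y z · x +ᵥ (det z x · y +ᵥ (det x y · z +ᵥ 0ᵥ)) ≡ 0ᵥ
cramer (a , b) (c , d) (e , f) = cong₂ _,_ (eq₁ a b c d e f) (eq₂ a b c d e f)
  where
  eq₁ : ∀ a b c d e f →
    (c * f -ᶻ d * e) * a +ᶻ ((e * b -ᶻ f * a) * c +ᶻ ((a * d -ᶻ b * c) * e +ᶻ 0ℤ)) ≡ 0ℤ
  eq₁ = solve-∀
  eq₂ : ∀ a b c d e f →
    (c * f -ᶻ d * e) * b +ᶻ ((e * b -ᶻ f * a) * d +ᶻ ((a * d -ᶻ b * c) * f +ᶻ 0ℤ)) ≡ 0ℤ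
  eq₂ = solve-∀

cramer-solve : ∀ x y z → det x y · z ≡ det z y · x +ᵥ det x z · y
cramer-solve (a , b) (c , d) (e , f) = cong₂ _,_ (eq₁ a b c d e f) (eq₂ a b c d e f)
  where
  eq₁ : ∀ a b c d e f →
    (a * d -ᶻ b * c) * e ≡ (e * d -ᶻ f * c) * a +ᶻ (a * f -ᶻ b * e) * c
  eq₁ = solve-∀
  eq₂ : ∀ a b c d e f →
    (a * d -ᶻ b * c) * f ≡ (e * d -ᶻ f * c) * b +ᶻ (a * f -ᶻ b * e) * d
  eq₂ = solve-∀

cramer-scaled : ∀ n x y z → det x y · n · z ≡ det z y · n · x +ᵥ det x z · n · y
cramer-scaled n x y z =
  trans (·-comm (det x y) n z) (trans (cong (n ·_) (cramer-solve x y z))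
    (trans (·-distribˡ n (det z y · x) (det x z · y))
      (cong₂ _+ᵥ_ (·-comm n (det z y) x) (·-comm n (det x z) y))))

-- The sum of the Cramer relations of (w, z, y) and (w, y, y′).
double-cramer : ∀ w y y′ z →
  (det z y +ᶻ det y y′) · w +ᵥ ((det w z +ᶻ det y′ w) · y +ᵥ
    (det w y · y′ +ᵥ (det y w · z +ᵥ 0ᵥ))) ≡ 0ᵥ
double-cramer (a , b) (c , d) (e , f) (g , h) =
  cong₂ _,_ (eq₁ a b c d e f g h) (eq₂ a b c d e f g h)
  where
  eq₁ : ∀ a b c d e f g h →
    ((g * d -ᶻ h * c) +ᶻ (c * f -ᶻ d * e)) * a +ᶻ
    (((a * h -ᶻ b * g) +ᶻ (e * b -ᶻ f * a)) * c +ᶻ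
    ((a * d -ᶻ b * c) * e +ᶻ ((c * b -ᶻ d * a) * g +ᶻ 0ℤ))) ≡ 0ℤ
  eq₁ = solve-∀
  eq₂ : ∀ a b c d e f g h →
    ((g * d -ᶻ h * c) +ᶻ (c * f -ᶻ d * e)) * b +ᶻ
    (((a * h -ᶻ b * g) +ᶻ (e * b -ᶻ f * a)) * d +ᶻ
    ((a * d -ᶻ b * c) * f +ᶻ ((c * b -ᶻ d * a) * h +ᶻ 0ℤ))) ≡ 0ℤ
  eq₂ = solve-∀

-- Lists: extracting a failing term, and double counting.

extract : ∀ {a p} {A : Set a} {P : Pred A p} → Decidable P → ∀ xs →
          All P xs ⊎ (∃₂ λ x ys → ¬ P x × xs ↭ x ∷ ys)
extract P? [] = inj₁ []
extract P? (x ∷ xs) with P? x | extract P? xs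
... | no ¬px | _                        = inj₂ (x , xs , ¬px , refl)
... | yes px | inj₁ all                 = inj₁ (px ∷ all)
... | yes _  | inj₂ (y , ys , ¬py , eq) =
  inj₂ (y , x ∷ ys , ¬py , ↭-trans (prep x eq) (swap x y refl))

sum-map-+ : ∀ {a} {A : Set a} (f g : A → ℕ) is →
            sumℕ (map (λ i → f i + g i) is) ≡ sumℕ (map f is) + sumℕ (map g is)
sum-map-+ f g []       = refl
sum-map-+ f g (i ∷ is) = trans (cong (λ n → f i + g i + n) (sum-map-+ f g is))
  (interchange (f i) (g i) (sumℕ (map f is)) (sumℕ (map g is)))
  where
  interchange : ∀ a b c d → (a + b) + (c + d) ≡ (a + c) + (b + d)
  interchange = ℕSolver.solve-∀

module _ {a p} {A : Set a} {P : ℕ → Pred A p} (P? : ∀ i → Decidable (P i)) where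

  private
    count : List A → ℕ → ℕ
    count xs i = length (filter (P? i) xs)

  count-∷ : ∀ x xs i → count (x ∷ xs) i ≡ count (x ∷ []) i + count xs i
  count-∷ x xs i = trans (cong length (filter-++ (P? i) (x ∷ []) xs))
                         (length-++ (filter (P? i) (x ∷ [])))

  sum-count-none : ∀ {x is} → All (λ i → ¬ P i x) is → sumℕ (map (count (x ∷ [])) is) ≡ 0
  sum-count-none []              = refl
  sum-count-none {is = i ∷ _} (¬px ∷ ¬ps) =
    cong₂ _+_ (cong length (filter-reject (P? i) ¬px)) (sum-count-none ¬ps)

  sum-count-unique : ∀ {x is j} → Unique is → j ∈ is → P j x → (∀ {i} → P i x → i ≡ j) →
                     sumℕ (map (count (x ∷ [])) is) ≡ 1
  sum-count-unique {is = j ∷ _} (j∉ ∷ _) (here refl) px unique =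
    cong₂ _+_ (cong length (filter-accept (P? j) px))
              (sum-count-none (All.map (λ j≢i pi → j≢i (sym (unique pi))) j∉))
  sum-count-unique {is = i ∷ _} (i∉ ∷ uniq) (there j∈) px unique =
    cong₂ _+_ (cong length (filter-reject (P? i) λ pi → All.lookup i∉ j∈ (unique pi)))
              (sum-count-unique uniq j∈ px unique)

  sum-count-const-0 : ∀ is → sumℕ (map (count []) is) ≡ 0
  sum-count-const-0 []       = refl
  sum-count-const-0 (_ ∷ is) = sum-count-const-0 is

  -- Double counting: each element is caught by exactly one of the filters, so it contributes 1 to
  -- the sum.
  sum-length-filter : ∀ {is xs} → Unique is →
    All (λ x → ∃[ j ] j ∈ is × P j x × (∀ {i} → P i x → i ≡ j)) xs →
    sumℕ (map (λ i → length (filter (P? i) xs)) is) ≡ length xs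
  sum-length-filter {is} _ [] = sum-count-const-0 is
  sum-length-filter {is} {x ∷ xs} uniq ((j , j∈ , pj , unique) ∷ ps) =
    trans (cong sumℕ (map-cong (count-∷ x xs) is))
      (trans (sum-map-+ (count (x ∷ [])) (count xs) is)
        (cong₂ _+_ (sum-count-unique uniq j∈ pj unique) (sum-length-filter uniq ps)))

-- Arithmetic modulo `p` and unit combinations.

module PrimePlane (p : ℕ) (p-prime : Prime p) where

  Unit : ℤ → Set
  Unit u = ¬ (+ p ∣ᶻ u)

  2≤p : 2 ≤ p
  2≤p = ℕ.nonTrivial⇒n>1 p ⦃ prime⇒nonTrivial p-prime ⦄

  euclid : ∀ a b → + p ∣ᶻ a * b → + p ∣ᶻ a ⊎ + p ∣ᶻ b
  euclid a b p∣ab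
    with euclidsLemma ∣ a ∣ ∣ b ∣ p-prime (subst (p ℕ.∣_) (ℤ.abs-* a b) (∣⇒∣ᵤ p∣ab))
  ... | inj₁ p∣a = inj₁ (∣ᵤ⇒∣ p∣a)
  ... | inj₂ p∣b = inj₂ (∣ᵤ⇒∣ p∣b)

  unit-* : ∀ {a b} → Unit a → Unit b → Unit (a * b)
  unit-* {a} {b} ua ub = [ ua , ub ]′ ∘ euclid a b

  unit-+ : ∀ {a b} → Unit a → + p ∣ᶻ b → Unit (a +ᶻ b)
  unit-+ ua p∣b p∣a+b = ua (∣m+n∣n⇒∣m p∣a+b p∣b)

  unit-1 : Unit 1ℤ
  unit-1 p∣1 = ℕ.nonTrivial⇒≢1 ⦃ prime⇒nonTrivial p-prime ⦄ (ℕ.∣1⇒≡1 (∣⇒∣ᵤ p∣1))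

  ∣-det-swap : ∀ u v → + p ∣ᶻ det u v → + p ∣ᶻ det v u
  ∣-det-swap u v d = subst (+ p ∣ᶻ_) (sym (det-antisym u v)) (∣m⇒∣-m d)

  unit-det-swap : ∀ u v → Unit (det u v) → Unit (det v u)
  unit-det-swap u v d = d ∘ ∣-det-swap v u

  ∣-det-self : ∀ v → + p ∣ᶻ det v v
  ∣-det-self v = divides 0ℤ (det-self v)

  infix 4 _∣ᵥ_ _∣ᵥ?_

  _∣ᵥ_ : ℤ → V → Set
  n ∣ᵥ (a , b) = n ∣ᶻ a × n ∣ᶻ b

  _∣ᵥ?_ : ∀ n → Decidable (n ∣ᵥ_)
  n ∣ᵥ? (a , b) = n ∣? a ×-dec n ∣? b

  ∣ᵥ⇒∣-det : ∀ u v → + p ∣ᵥ v → + p ∣ᶻ det u v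
  ∣ᵥ⇒∣-det (a , b) (c , d) (p∣c , p∣d) = ∣m∣n⇒∣m-n (∣n⇒∣m*n a p∣d) (∣n⇒∣m*n b p∣c)

  complement : ∀ v → ¬ (+ p ∣ᵥ v) → ∃[ g ] Unit (det v g)
  complement (a , b) p∤v with + p ∣? a
  ... | no p∤a  = (0ℤ , 1ℤ) , p∤a ∘ subst (+ p ∣ᶻ_) (eq a b)
    where
    eq : ∀ a b → a * 1ℤ -ᶻ b * 0ℤ ≡ a
    eq = solve-∀
  ... | yes p∣a = (ℤ.- 1ℤ , 0ℤ) , λ p∣b → p∤v (p∣a , subst (+ p ∣ᶻ_) (eq a b) p∣b)
    where
    eq : ∀ a b → a * 0ℤ -ᶻ b * (ℤ.- 1ℤ) ≡ b
    eq = solve-∀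

  -- Coefficients are arbitrary integers prime to `p`; their reduction to the weights is postponed
  -- to `weight`. The index counts the terms taken, so that `suc n` in `Independent` excludes the
  -- empty combination.
  data UnitComb : ℕ → List V → V → Set where
    []   : UnitComb 0 [] 0ᵥ
    skip : ∀ {n x xs v} → UnitComb n xs v → UnitComb n (x ∷ xs) v
    take : ∀ {n x xs v} u → Unit u → UnitComb n xs v →
           UnitComb (suc n) (x ∷ xs) (u · x +ᵥ v)

  emptyComb : ∀ xs → UnitComb 0 xs 0ᵥ
  emptyComb []       = []
  emptyComb (x ∷ xs) = skip (emptyComb xs)

  UnitComb-resp-↭ : ∀ {n xs ys v} → xs ↭ ys → UnitComb n xs v → UnitComb n ys v
  UnitComb-resp-↭ refl c = c
  UnitComb-resp-↭ (↭-trans p q) c = UnitComb-resp-↭ q (UnitComb-resp-↭ p c)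
  UnitComb-resp-↭ (prep x p) (skip c)     = skip (UnitComb-resp-↭ p c)
  UnitComb-resp-↭ (prep x p) (take u i c) = take u i (UnitComb-resp-↭ p c)
  UnitComb-resp-↭ (swap x y p) (skip (skip c))         = skip (skip (UnitComb-resp-↭ p c))
  UnitComb-resp-↭ (swap x y p) (skip (take u i c))     = take u i (skip (UnitComb-resp-↭ p c))
  UnitComb-resp-↭ (swap x y p) (take u i (skip c))     = skip (take u i (UnitComb-resp-↭ p c))
  UnitComb-resp-↭ (swap x y p) (take u i (take {v = v} w j c)) =
    subst (UnitComb _ _) (+ᵥ-swap (w · y) (u · x) v)
      (take w j (take u i (UnitComb-resp-↭ p c)))

  -- Subgroups, independence and lines modulo `p`.

  -- `saturated` says that the quotient of ℤ² has no torsion prime to `p`, so unit determinants can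
  -- be cancelled. `mem?` is there to decide whether a power of `p` kills a given vector of the
  -- quotient.
  record Subgroup : Set₁ where
    field
      Mem       : V → Set
      mem?      : ∀ v → Dec (Mem v)
      mem-0     : Mem 0ᵥ
      mem-+     : ∀ {u v} → Mem u → Mem v → Mem (u +ᵥ v)
      mem-·     : ∀ k {v} → Mem v → Mem (k · v)
      saturated : ∀ {k v} → Unit k → Mem (k · v) → Mem v

  module _ (K : Subgroup) where
    open Subgroup K

    Independent : List V → Set
    Independent xs = ∀ {n v} → UnitComb (suc n) xs v → ¬ Mem v

    independent-∈ : ∀ {xs x} → Independent xs → x ∈ xs → ¬ Mem x
    independent-∈ {x ∷ xs} ind (here refl) m =
      ind (take 1ℤ unit-1 (emptyComb xs)) (mem-+ (mem-· 1ℤ m) mem-0)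
    independent-∈ {x ∷ xs} ind (there i) = independent-∈ (λ c → ind (skip c)) i

    independent-resp-↭ : ∀ {xs ys} → xs ↭ ys → Independent xs → Independent ys
    independent-resp-↭ eq ind c = ind (UnitComb-resp-↭ (↭-sym eq) c)

    data Dichotomy (w : V) (xs : List V) : Set where
      onLine    : All (λ x → + p ∣ᶻ det w x) xs → Dichotomy w xs
      offByOne  : ∀ x ys → xs ↭ x ∷ ys → Unit (det w x) →
                  All (λ x → + p ∣ᶻ det w x) ys → Dichotomy w xs

    line? : ∀ w → Decidable (λ x → + p ∣ᶻ det w x)
    line? w x = + p ∣? det w x

    -- Two terms `x`, `y` off the line of `k` would have a unit combination equal to `det x y · k`,
    -- which lies in `K`. Only the coefficients of `x` and `y` must be units, so `det x y` is
    -- unrestricted.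
    dichotomy-mem : ∀ {k xs} → Mem k → Independent xs → Dichotomy k xs
    dichotomy-mem {k} {xs} k∈K ind with extract (line? k) xs
    ... | inj₁ all = onLine all
    ... | inj₂ (x , ys , ux , eq) with extract (line? k) ys
    ...   | inj₁ all = offByOne x ys eq ux all
    ...   | inj₂ (y , zs , uy , eq′) =
      contradiction
        (subst Mem (sym rel) (mem-· (det x y) k∈K))
        (independent-resp-↭ (↭-trans eq (prep x eq′)) ind
          (take (det k y) uy (take (det x k) (unit-det-swap k x ux) (emptyComb zs))))
      where
      rel : det k y · x +ᵥ (det x k · y +ᵥ 0ᵥ) ≡ det x y · k
      rel = trans (cong (det k y · x +ᵥ_) (+ᵥ-identityʳ _)) (sym (cramer-solve x y k))

    -- Terms are drawn off successive lines: `w` nonzero modulo `p`, then `y` and `y′` off the line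
    -- of `w`, then `z` off the line of `y`. Either the search stops at a suitable line, or the
    -- terms found satisfy a relation with unit coefficients.
    dichotomy : ∀ {xs} → Independent xs → ∃₂ λ w g → Unit (det w g) × Dichotomy w xs
    dichotomy {xs} ind with extract (+ p ∣ᵥ?_) xs
    -- Every term vanishes modulo `p`, so any line serves.
    ... | inj₁ all = (1ℤ , 0ℤ) , (0ℤ , 1ℤ) , unit-1 ,
      onLine (All.map (λ {x} → ∣ᵥ⇒∣-det (1ℤ , 0ℤ) x) all)
    ... | inj₂ (w , ys , w≢0 , eq) with complement w w≢0 | extract (line? w) ys
    ...   | g , ug | inj₁ all =
      w , g , ug , onLine (All-resp-↭ (↭-sym eq) (∣-det-self w ∷ all))
    ...   | g , ug | inj₂ (y , zs , wy , eq₂) with extract (line? w) zs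
    ...     | inj₁ all =
      w , g , ug , offByOne y (w ∷ zs) (↭-trans eq (↭-trans (prep w eq₂) (swap w y refl))) wy
                     (∣-det-self w ∷ all)
    ...     | inj₂ (y′ , rs , wy′ , eq₃) with + p ∣? det y y′
    ...       | no yy′ =
      contradiction (subst Mem (sym (cramer w y y′)) mem-0)
        (independent-resp-↭ (↭-trans eq (prep w (↭-trans eq₂ (prep y eq₃)))) ind
          (take _ yy′ (take _ (unit-det-swap w y′ wy′) (take _ wy (emptyComb rs)))))
    ...       | yes yy′ with extract (line? y) rs
    -- The line is now that of `y`, which contains `y′`; the first term `w` becomes the exceptional
    -- one.
    ...         | inj₁ all =
      y , w , unit-det-swap w y wy ,
      offByOne w (y ∷ y′ ∷ rs) (↭-trans eq (prep w (↭-trans eq₂ (prep y eq₃))))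
        (unit-det-swap w y wy) (∣-det-self y ∷ yy′ ∷ all)
    ...         | inj₂ (z , ts , yz , eq₄) with + p ∣? det w z
    ...           | no wz =
      contradiction (subst Mem (sym (cramer w y z)) mem-0)
        (independent-resp-↭ eq′ ind
          (take _ yz (take _ (unit-det-swap w z wz) (skip (take _ wy (emptyComb ts))))))
      where
      eq′ : xs ↭ w ∷ y ∷ y′ ∷ z ∷ ts
      eq′ = ↭-trans eq (prep w (↭-trans eq₂ (prep y (↭-trans eq₃ (prep y′ eq₄)))))
    ...           | yes wz =
      contradiction (subst Mem (sym (double-cramer w y y′ z)) mem-0)
        (independent-resp-↭ eq′ ind
          -- The first two coefficients are each a unit plus a multiple of `p`, because modulo `p`
          -- the vector `y` is parallel to `y′` and `w` to `z`.
          (take _ (unit-+ (unit-det-swap y z yz) yy′)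
          (take (det w z +ᶻ det y′ w)
            (subst Unit (ℤ.+-comm (det y′ w) (det w z)) (unit-+ (unit-det-swap w y′ wy′) wz))
          (take _ wy (take _ (unit-det-swap w y wy) (emptyComb ts))))))
      where
      eq′ : xs ↭ w ∷ y ∷ y′ ∷ z ∷ ts
      eq′ = ↭-trans eq (prep w (↭-trans eq₂ (prep y (↭-trans eq₃ (prep y′ eq₄)))))

  -- Lattices of index `p` and their coordinates.

  module Sublattice (w g : V) (w∧g : Unit (det w g)) where

    -- Parametrises {v : p ∣ det w v} by ℤ², up to the unit det w g (see embed-coords).
    embed : V → V
    embed (a , b) = a · w +ᵥ b · + p · g

    coords : ∀ {v} → + p ∣ᶻ det w v → V
    coords {v} (divides q _) = det v g , q

    embed-coords : ∀ {v} (p∣ : + p ∣ᶻ det w v) → embed (coords {v} p∣) ≡ det w g · v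
    embed-coords {v} (divides q eq) = sym (trans (cramer-solve w g v)
      (cong (det v g · w +ᵥ_) (trans (cong (_· g) eq) (·-assoc q (+ p) g))))

    embed-+ : ∀ u v → embed (u +ᵥ v) ≡ embed u +ᵥ embed v
    embed-+ (a , b) (c , d) =
      cong₂ _,_ (eq a b c d (proj₁ w) (proj₁ (+ p · g))) (eq a b c d (proj₂ w) (proj₂ (+ p · g)))
      where
      eq : ∀ a b c d x y →
        (a +ᶻ c) * x +ᶻ (b +ᶻ d) * y ≡ (a * x +ᶻ b * y) +ᶻ (c * x +ᶻ d * y)
      eq = solve-∀

    embed-· : ∀ k v → embed (k · v) ≡ k · embed v
    embed-· k (a , b) =
      cong₂ _,_ (eq k a b (proj₁ w) (proj₁ (+ p · g))) (eq k a b (proj₂ w) (proj₂ (+ p · g)))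
      where
      eq : ∀ k a b x y → (k * a) * x +ᶻ (k * b) * y ≡ k * (a * x +ᶻ b * y)
      eq = solve-∀

    -- The three-term Plücker relation. Up to the unit `det w g`, coordinates divide determinants by
    -- `p`, which lowers the exponent in the induction.
    det-coords : ∀ {u v} (p∣u : + p ∣ᶻ det w u) (p∣v : + p ∣ᶻ det w v) →
                 det (coords {u} p∣u) (coords {v} p∣v) * + p ≡ det w g * det u v
    det-coords {u} {v} (divides q eq) (divides r eq′) =
      trans (lemma (det u g) r q (det v g) (+ p))
        (trans (cong₂ (λ m n → det u g * m -ᶻ n * det v g) (sym eq′) (sym eq))
          (plücker (proj₁ w) (proj₂ w) (proj₁ g) (proj₂ g)
                   (proj₁ u) (proj₂ u) (proj₁ v) (proj₂ v)))
      where
      lemma : ∀ a r q b n → (a * r -ᶻ q * b) * n ≡ a * (r * n) -ᶻ (q * n) * b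
      lemma = solve-∀
      plücker : ∀ a b c d e f g h →
        (e * d -ᶻ f * c) * (a * h -ᶻ b * g) -ᶻ (a * f -ᶻ b * e) * (g * d -ᶻ h * c)
        ≡ (a * d -ᶻ b * c) * (e * h -ᶻ f * g)
      plücker = solve-∀

    allCoords : ∀ {xs} → All (λ x → + p ∣ᶻ det w x) xs → List V
    allCoords = All.reduce (λ {x} → coords {x})

    length-allCoords : ∀ {xs} (ps : All _ xs) → length (allCoords ps) ≡ length xs
    length-allCoords []       = refl
    length-allCoords (_ ∷ ps) = cong suc (length-allCoords ps)

    ∈-allCoords : ∀ {xs y} (ps : All _ xs) → y ∈ allCoords ps →
                  ∃[ x ] x ∈ xs × embed y ≡ det w g · x
    ∈-allCoords {x ∷ _} (p∣ ∷ ps) (here refl) = x , here refl , embed-coords p∣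
    ∈-allCoords (_ ∷ ps) (there i) with ∈-allCoords ps i
    ... | x , x∈xs , eq = x , there x∈xs , eq

    -- Each coefficient picks up the factor `det w g` and remains a unit; this is how independence
    -- descends to the lattice.
    embed-UnitComb : ∀ {n xs v} (ps : All _ xs) →
                     UnitComb n (allCoords ps) v → UnitComb n xs (embed v)
    embed-UnitComb [] [] = []
    embed-UnitComb (_ ∷ ps) (skip c) = skip (embed-UnitComb ps c)
    embed-UnitComb {xs = x ∷ _} (p∣ ∷ ps) (take {v = v} u i c) =
      subst (UnitComb _ _) (sym eq)
        (take (u * det w g) (unit-* i w∧g) (embed-UnitComb ps c))
      where
      eq : embed (u · coords {x} p∣ +ᵥ v) ≡ (u * det w g) · x +ᵥ embed v
      eq = trans (embed-+ (u · coords {x} p∣) v)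
        (cong (_+ᵥ embed v) (trans (embed-· u (coords {x} p∣))
          (trans (cong (u ·_) (embed-coords p∣)) (sym (·-assoc u (det w g) x)))))

    pullback : Subgroup → Subgroup
    pullback K = record
      { Mem       = Mem ∘ embed
      ; mem?      = mem? ∘ embed
      ; mem-0     = mem-0
      ; mem-+     = λ {u} {v} m n → subst Mem (sym (embed-+ u v)) (mem-+ m n)
      ; mem-·     = λ k {v} m → subst Mem (sym (embed-· k v)) (mem-· k m)
      ; saturated = λ {k} {v} uk m → saturated uk (subst Mem (embed-· k v) m)
      }
      where open Subgroup K

    coords-mem : ∀ K {v} (p∣ : + p ∣ᶻ det w v) →
                 Subgroup.Mem K v → Subgroup.Mem (pullback K) (coords {v} p∣)
    coords-mem K p∣ m = subst Mem (sym (embed-coords p∣)) (mem-· (det w g) m)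
      where open Subgroup K

    independent-allCoords : ∀ K {xs} (ps : All _ xs) →
                            Independent K xs → Independent (pullback K) (allCoords ps)
    independent-allCoords K ps ind c = ind (embed-UnitComb ps c)

  -- Induction on the index.

  -- Order exactly `p ^ suc j` modulo `K`; the shift leaves out order 1.
  HasOrderIn : Subgroup → ℕ → V → Set
  HasOrderIn K j x = Mem (+ (p ^ suc j) · x) × ¬ Mem (+ (p ^ j) · x)
    where open Subgroup K

  -- The second clause speaks of powers that fail to kill some `v` rather than of a fixed exponent,
  -- because passing to the sublattice may or may not lower the exponent of the quotient.
  Filtered : Subgroup → ℕ → List V → Set
  Filtered K s xs =
    length xs ≤ s ×
    (length xs ≡ s → ∀ j v → ¬ Subgroup.Mem K (+ (p ^ j) · v) → ∃[ x ] x ∈ xs × HasOrderIn K j x)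

  module _ (w g : V) (w∧g : Unit (det w g)) (K : Subgroup) where
    open Sublattice w g w∧g
    open Subgroup K

    hasOrder-pullback : ∀ {j x y} → embed y ≡ det w g · x →
                        HasOrderIn (pullback K) j y → HasOrderIn K j x
    hasOrder-pullback {j} {x} {y} eq (m , ¬m) =
      saturated w∧g (subst Mem (scale (p ^ suc j)) m) ,
      λ m′ → ¬m (subst Mem (sym (scale (p ^ j))) (mem-· (det w g) m′))
      where
      scale : ∀ n → embed (+ n · y) ≡ det w g · + n · x
      scale n = trans (embed-· (+ n) y) (trans (cong (+ n ·_) eq) (·-comm (+ n) (det w g) x))

    -- Cramer's rule is used twice: over `w`, `g` it expresses `x`, giving the upper bound on the
    -- order; over `w`, `x` it expresses `v`, so killing `x` by `p ^ j` would kill `v`.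
    hasOrder-offLine : ∀ {j x v} → Unit (det w x) →
      Mem (+ (p ^ j) · w) → Mem (+ (p ^ j) · + p · g) →
      ¬ Mem (+ (p ^ j) · v) → HasOrderIn K j x
    hasOrder-offLine {j} {x} {v} ux mw mg ¬mv =
      saturated w∧g (subst Mem (sym (cramer-scaled (+ (p ^ suc j)) w g x))
        (mem-+ (mem-· (det x g) (subst Mem (sym (power-suc w)) (mem-· (+ p) mw)))
               (mem-· (det w x) (subst Mem (sym power-g) mg)))) ,
      λ mx → ¬mv (saturated ux (subst Mem (sym (cramer-scaled (+ (p ^ j)) w x v))
        (mem-+ (mem-· (det v x) mw) (mem-· (det w v) mx))))
      where
      power-suc : ∀ u → + (p ^ suc j) · u ≡ + p · + (p ^ j) · u
      power-suc u = trans (cong (_· u) (ℤ.pos-* p (p ^ j))) (·-assoc (+ p) (+ (p ^ j)) u)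
      power-g : + (p ^ suc j) · g ≡ + (p ^ j) · + p · g
      power-g = trans (power-suc g) (·-comm (+ p) (+ (p ^ j)) g)

    filtered-suc : ∀ {s xs} → Independent K xs → Dichotomy K w xs →
      (∀ {ys} → Independent (pullback K) ys → Filtered (pullback K) s ys) →
      Filtered K (suc s) xs
    filtered-suc {s} {xs} ind (onLine ps) ih =
      -- A list inside the lattice has at most `s` terms, so it never attains `suc s` and the order
      -- clause is vacuous.
      ℕ.m≤n⇒m≤1+n len , λ eq → contradiction (subst (_≤ s) eq len) (ℕ.<-irrefl refl)
      where
      len : length xs ≤ s
      len = subst (_≤ s) (length-allCoords ps) (proj₁ (ih (independent-allCoords K ps ind)))
    filtered-suc {s} {xs} ind (offByOne x ys xs↭ ux ps) ih =
      subst (_≤ suc s) (sym (↭-length xs↭)) (s≤s len) , order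
      where
      ih′ : Filtered (pullback K) s (allCoords ps)
      ih′ = ih (independent-allCoords K ps (λ c → independent-resp-↭ K xs↭ ind (skip c)))
      len : length ys ≤ s
      len = subst (_≤ s) (length-allCoords ps) (proj₁ ih′)

      order : length xs ≡ suc s → ∀ j v → ¬ Mem (+ (p ^ j) · v) →
              ∃[ y ] y ∈ xs × HasOrderIn K j y
      order eq j v ¬mv = go (mem? (+ (p ^ j) · w)) (mem? (+ (p ^ j) · + p · g))
        where
        length≡s : length (allCoords ps) ≡ s
        length≡s = trans (length-allCoords ps) (ℕ.suc-injective (trans (sym (↭-length xs↭)) eq))

        embed-e₁ : embed (1ℤ , 0ℤ) ≡ w
        embed-e₁ = cong₂ _,_ (lemma (proj₁ w) (proj₁ (+ p · g))) (lemma (proj₂ w) (proj₂ (+ p · g)))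
          where
          lemma : ∀ a b → 1ℤ * a +ᶻ 0ℤ * b ≡ a
          lemma = solve-∀

        embed-e₂ : embed (0ℤ , 1ℤ) ≡ + p · g
        embed-e₂ = cong₂ _,_ (lemma (proj₁ w) (proj₁ (+ p · g))) (lemma (proj₂ w) (proj₂ (+ p · g)))
          where
          lemma : ∀ a b → 0ℤ * a +ᶻ 1ℤ * b ≡ b
          lemma = solve-∀

        below : ∀ e u → embed e ≡ u → ¬ Mem (+ (p ^ j) · u) → ∃[ y ] y ∈ xs × HasOrderIn K j y
        below e u eq ¬mu
          with proj₂ ih′ length≡s j e
                 (¬mu ∘ subst Mem (trans (embed-· (+ (p ^ j)) e) (cong (+ (p ^ j) ·_) eq)))
        ... | z , z∈ , ord with ∈-allCoords ps z∈
        ...   | y , y∈ , eq′ =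
          y , ∈-resp-↭ (↭-sym xs↭) (there y∈) , hasOrder-pullback {j} eq′ ord

        go : Dec _ → Dec _ → ∃[ y ] y ∈ xs × HasOrderIn K j y
        -- The vectors `w` and `+ p · g` span the image of `embed`, so these two tests decide
        -- whether `p ^ j` kills it.
        go (no ¬mw) _         = below (1ℤ , 0ℤ) w embed-e₁ ¬mw
        go (yes _)  (no ¬mg)  = below (0ℤ , 1ℤ) (+ p · g) embed-e₂ ¬mg
        go (yes mw) (yes mg)  =
          x , ∈-resp-↭ (↭-sym xs↭) (here refl) , hasOrder-offLine {j} {x} {v} ux mw mg ¬mv

  -- Both `k₁` and `k₂` lie on the line, so their coordinates witness the determinant hypothesis for
  -- `pullback K` with one factor `p` fewer.
  filtered-by-line : ∀ K {s w xs} g → Unit (det w g) → Independent K xs → Dichotomy K w xs →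
    ∀ {k₁ k₂ t} → Subgroup.Mem K k₁ → Subgroup.Mem K k₂ → Unit t →
    det k₁ k₂ ≡ t * + (p ^ suc s) → + p ∣ᶻ det w k₁ → + p ∣ᶻ det w k₂ →
    (∀ K {k₁ k₂ t ys} → Subgroup.Mem K k₁ → Subgroup.Mem K k₂ → Unit t →
      det k₁ k₂ ≡ t * + (p ^ s) → Independent K ys → Filtered K s ys) →
    Filtered K (suc s) xs
  filtered-by-line K {s} {w} g w∧g ind dich {k₁} {k₂} {t} m₁ m₂ ut eq p∣₁ p∣₂ ih =
    filtered-suc w g w∧g K ind dich
      (ih (pullback K) {coords {k₁} p∣₁} {coords {k₂} p∣₂}
        (coords-mem K p∣₁ m₁) (coords-mem K p∣₂ m₂) (unit-* w∧g ut)
        (ℤ.*-cancelʳ-≡ _ _ (+ p) ⦃ prime⇒nonZero p-prime ⦄ scaled))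
    where
    open Sublattice w g w∧g
    scaled : det (coords {k₁} p∣₁) (coords {k₂} p∣₂) * + p ≡ ((det w g * t) * + (p ^ s)) * + p
    scaled = trans (det-coords {k₁} {k₂} p∣₁ p∣₂)
      (trans (cong (det w g *_) (trans eq (cong (t *_) (ℤ.pos-* p (p ^ s)))))
        (lemma (det w g) t (+ p) (+ (p ^ s))))
      where
      lemma : ∀ d t n m → d * (t * (n * m)) ≡ ((d * t) * m) * n
      lemma = solve-∀

  -- The determinant hypothesis says that the p-part of ℤ²/K has order at most p ^ s.
  filtered : ∀ s K {k₁ k₂ t xs} → Subgroup.Mem K k₁ → Subgroup.Mem K k₂ → Unit t →
             det k₁ k₂ ≡ t * + (p ^ s) → Independent K xs → Filtered K s xs
  filtered zero K {k₁} {k₂} {t} {xs} m₁ m₂ ut eq ind =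
    len xs ind , λ _ j v ¬m → contradiction (mem-· (+ (p ^ j)) (all v)) ¬m
    where
    open Subgroup K
    all : ∀ v → Mem v
    -- The determinant of `k₁` and `k₂` is now the unit `t` itself, so they span everything up to
    -- units.
    all v = saturated (subst Unit (sym (trans eq (ℤ.*-identityʳ t))) ut)
      (subst Mem (sym (cramer-solve k₁ k₂ v)) (mem-+ (mem-· (det v k₂) m₁) (mem-· (det k₁ v) m₂)))
    len : ∀ xs → Independent K xs → length xs ≤ 0
    len []       _   = z≤n
    len (x ∷ xs) ind = contradiction (all x) (independent-∈ K ind (here refl))
  filtered (suc s) K {k₁} {k₂} {t} m₁ m₂ ut eq ind with + p ∣ᵥ? k₁ | + p ∣ᵥ? k₂
  -- A vector of `K` outside pℤ² dictates the line; `k₂` lies on it because `p` divides `det k₁ k₂`.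
  ... | no k₁≢0 | _ with complement k₁ k₁≢0
  ...   | g , ug = filtered-by-line K g ug ind (dichotomy-mem K m₁ ind) m₁ m₂ ut eq
                     (∣-det-self k₁) p∣det (filtered s)
    where
    p∣det : + p ∣ᶻ det k₁ k₂
    p∣det = subst (+ p ∣ᶻ_) (sym eq) (∣n⇒∣m*n t (∣ᵤ⇒∣ (ℕ.m∣m*n (p ^ s))))
  filtered (suc s) K {k₁} {k₂} {t} m₁ m₂ ut eq ind | yes _ | no k₂≢0 with complement k₂ k₂≢0
  ...   | g , ug = filtered-by-line K g ug ind (dichotomy-mem K m₂ ind) m₁ m₂ ut eq
                     (∣-det-swap k₁ k₂ p∣det) (∣-det-self k₂) (filtered s)
    where
    p∣det : + p ∣ᶻ det k₁ k₂
    p∣det = subst (+ p ∣ᶻ_) (sym eq) (∣n⇒∣m*n t (∣ᵤ⇒∣ (ℕ.m∣m*n (p ^ s))))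
  -- Both vectors lie in pℤ², hence on every line, so the terms alone may determine the line.
  filtered (suc s) K {k₁} {k₂} {t} m₁ m₂ ut eq ind | yes p∣k₁ | yes p∣k₂ with dichotomy K ind
  ...   | w , g , ug , dich = filtered-by-line K g ug ind dich m₁ m₂ ut eq
                                (∣ᵥ⇒∣-det w k₁ p∣k₁) (∣ᵥ⇒∣-det w k₂ p∣k₂) (filtered s)

  -- Powers of `p` and orders of elements.

  -- Provides α + β ≤ 2α ≤ p^α. The inductive step uses `2 ≤ n + n`, hence the separate case of
  -- exponent 1.
  +-double≤^ : ∀ n → n + n ≤ p ^ n
  +-double≤^ zero = z≤n
  +-double≤^ (suc zero) = subst (2 ≤_) (sym (ℕ.*-identityʳ p)) 2≤p
  +-double≤^ (suc n@(suc _)) = begin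
    suc n + suc n          ≡⟨ ℕ.+-suc (suc n) n ⟩
    2 + (n + n)            ≤⟨ ℕ.+-monoˡ-≤ (n + n) (ℕ.+-mono-≤ {1} {n} {1} {n} (s≤s z≤n) (s≤s z≤n)) ⟩
    (n + n) + (n + n)      ≤⟨ ℕ.+-mono-≤ (+-double≤^ n) (+-double≤^ n) ⟩
    p ^ n + p ^ n          ≡⟨ cong (λ m → p ^ n + m) (ℕ.+-identityʳ (p ^ n)) ⟨
    2 ℕ.* p ^ n            ≤⟨ ℕ.*-monoˡ-≤ (p ^ n) 2≤p ⟩
    p ℕ.* p ^ n            ∎
    where open ℕ.≤-Reasoning

  ^-injective : ∀ {m n} → p ^ m ≡ p ^ n → m ≡ n
  ^-injective {m} {n} eq with ℕ.<-cmp m n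
  ... | tri< m<n _ _ = contradiction eq (ℕ.<⇒≢ (ℕ.^-monoʳ-< p 2≤p m<n))
  ... | tri≈ _ m≡n _ = m≡n
  ... | tri> _ _ n<m = contradiction (sym eq) (ℕ.<⇒≢ (ℕ.^-monoʳ-< p 2≤p n<m))

  unit-cancel-^ : ∀ n {k a} → Unit k → + (p ^ n) ∣ᶻ k * a → + (p ^ n) ∣ᶻ a
  unit-cancel-^ zero    {a = a} _  _ = divides a (sym (ℤ.*-identityʳ a))
  unit-cancel-^ (suc n) {k} {a} uk d
    with euclid k a (∣-trans (∣ᵤ⇒∣ (ℕ.m∣m*n (p ^ n))) d)
  ... | inj₁ p∣k = contradiction p∣k uk
  ... | inj₂ (divides q refl) =
    subst (_∣ᶻ q * + p) (sym pⁿ⁺¹) (*-monoˡ-∣ (+ p) (unit-cancel-^ n uk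
      (*-cancelʳ-∣ (+ p) ⦃ prime⇒nonZero p-prime ⦄
        (subst₂ _∣ᶻ_ pⁿ⁺¹ (sym (ℤ.*-assoc k q (+ p))) d))))
    where
    pⁿ⁺¹ : + (p ^ suc n) ≡ + (p ^ n) * + p
    pⁿ⁺¹ = trans (ℤ.pos-* p (p ^ n)) (ℤ.*-comm (+ p) (+ (p ^ n)))

  -- A `k` prime to `p` would put `v` itself in `K` by saturation; otherwise one factor `p` moves
  -- from `k` to `v`.
  order-∣ : ∀ K j {k v} → Subgroup.Mem K (k · v) → ¬ Subgroup.Mem K (+ (p ^ j) · v) →
            + (p ^ suc j) ∣ᶻ k
  order-∣ K j {k} {v} m ¬m with + p ∣? k
  ... | no uk = contradiction (mem-· (+ (p ^ j)) (saturated {k} {v} uk m)) ¬m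
    where open Subgroup K
  order-∣ K zero    {k} m ¬m | yes p∣k = subst (_∣ᶻ k) (cong +_ (sym (ℕ.*-identityʳ p))) p∣k
  order-∣ K (suc j) {v = v} m ¬m | yes (divides q refl) =
    subst (_∣ᶻ q * + p) (sym pʲ⁺²) (*-monoˡ-∣ (+ p)
      (order-∣ K j {q} {+ p · v} (subst Mem (·-assoc q (+ p) v) m)
        (¬m ∘ subst Mem (trans (sym (·-assoc (+ (p ^ j)) (+ p) v)) (cong (_· v) pʲ⁺¹)))))
    where
    open Subgroup K
    pʲ⁺² : + (p ^ suc (suc j)) ≡ + (p ^ suc j) * + p
    pʲ⁺² = trans (ℤ.pos-* p (p ^ suc j)) (ℤ.*-comm (+ p) (+ (p ^ suc j)))
    pʲ⁺¹ : + (p ^ j) * + p ≡ + (p ^ suc j)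
    pʲ⁺¹ = trans (ℤ.*-comm (+ (p ^ j)) (+ p)) (sym (ℤ.pos-* p (p ^ j)))

  order-exists : ∀ K n {v} → Subgroup.Mem K (+ (p ^ n) · v) → ¬ Subgroup.Mem K v →
                 ∃[ j ] j < n × HasOrderIn K j v
  order-exists K zero    {v} m ¬m = contradiction (subst (Subgroup.Mem K) (·-identityˡ v) m) ¬m
  order-exists K (suc n) {v} m ¬m with Subgroup.mem? K (+ (p ^ n) · v)
  ... | no ¬m′ = n , ℕ.≤-refl , m , ¬m′
  ... | yes m′ with order-exists K n m′ ¬m
  ...   | j , j<n , ord = j , ℕ.m≤n⇒m≤1+n j<n , ord

  -- The group as a quotient of ℤ², and its weights.

  module _ (α β : ℕ) (1≤α : 1 ≤ α) (β≤α : β ≤ α) where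

    private
      instance
        pα-nonZero : ℕ.NonZero (p ^ α)
        pα-nonZero = ℕ.m^n≢0 p α ⦃ prime⇒nonZero p-prime ⦄

    G : AbelianGroup 0ℓ 0ℓ
    G = ℤ/ (p ^ α) ⊕ℤ/ (p ^ β)

    open AbelianGroup G using (_≈_; _∙_; ε; ∙-cong) renaming (refl to ≈-refl; trans to ≈-trans)
    open RawMonoidDefs (AbelianGroup.rawMonoid G) using (sum) renaming (_×_ to _×ᴳ_)
    open Sequences G

    _≈?_ : Decidable₂ _≈_
    _≈?_ = ×-decidable (_≡ₙ?_ (p ^ α)) (_≡ₙ?_ (p ^ β))

    pᵝ∣pᵅ : + (p ^ β) ∣ᶻ + (p ^ α)
    pᵝ∣pᵅ = ∣ᵤ⇒∣ (subst (λ n → p ^ β ℕ.∣ p ^ n) (ℕ.m+[n∸m]≡n β≤α)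
      (subst (p ^ β ℕ.∣_) (sym (ℕ.^-distribˡ-+-* p β (α ℕ.∸ β))) (ℕ.m∣m*n (p ^ (α ℕ.∸ β)))))

    -- The carrier of `G` is ℤ × ℤ with a coarser equality, so the terms of `S` are their own lifts
    -- and only membership has to be translated.
    kernel : Subgroup
    kernel = record
      { Mem       = λ (a , b) → + (p ^ α) ∣ᶻ a × + (p ^ β) ∣ᶻ b
      ; mem?      = λ (a , b) → + (p ^ α) ∣? a ×-dec + (p ^ β) ∣? b
      ; mem-0     = divides 0ℤ refl , divides 0ℤ refl
      ; mem-+     = λ (a , b) (c , d) → ∣m∣n⇒∣m+n a c , ∣m∣n⇒∣m+n b d
      ; mem-·     = λ k (a , b) → ∣n⇒∣m*n k a , ∣n⇒∣m*n k b
      ; saturated = λ uk (a , b) → unit-cancel-^ α uk a , unit-cancel-^ β uk b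
      }

    open Subgroup kernel

    mem⇒≈ε : ∀ {v} → Mem v → v ≈ ε
    mem⇒≈ε {a , b} (m , n) =
      subst (+ (p ^ α) ∣ᶻ_) (sym (ℤ.+-identityʳ a)) m ,
      subst (+ (p ^ β) ∣ᶻ_) (sym (ℤ.+-identityʳ b)) n

    ≈ε⇒mem : ∀ {v} → v ≈ ε → Mem v
    ≈ε⇒mem {a , b} (m , n) =
      subst (+ (p ^ α) ∣ᶻ_) (ℤ.+-identityʳ a) m ,
      subst (+ (p ^ β) ∣ᶻ_) (ℤ.+-identityʳ b) n

    ×ᴳ≡· : ∀ n v → n ×ᴳ v ≡ + n · v
    ×ᴳ≡· zero    v       = refl
    ×ᴳ≡· (suc n) (a , b) = trans (cong ((a , b) +ᵥ_) (×ᴳ≡· n (a , b)))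
      (cong₂ _,_ (sym (ℤ.suc-* (+ n) a)) (sym (ℤ.suc-* (+ n) b)))

    -- The residue modulo `p ^ α` stays prime to `p` because `p` divides `p ^ α`; in particular it
    -- is not 0.
    weight : ∀ {u} → Unit u → ∃[ r ] Weights p α r × + (p ^ α) ∣ᶻ + r -ᶻ u
    weight {u} uu = r , (1≤r , ℕ.<⇒≤ (n%ℕd<d u (p ^ α)) , coprime⇒gcd≡1 coprime) , divides (ℤ.- q) eq
      where
      r = u %ℕ (p ^ α)
      q = u /ℕ (p ^ α)

      division : u ≡ + r +ᶻ q * + (p ^ α)
      division = a≡a%ℕn+[a/ℕn]*n u (p ^ α)

      eq : + r -ᶻ u ≡ ℤ.- q * + (p ^ α)
      eq = trans (cong (+ r -ᶻ_) division) (lemma (+ r) q (+ (p ^ α)))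
        where
        lemma : ∀ r q n → r -ᶻ (r +ᶻ q * n) ≡ ℤ.- q * n
        lemma = solve-∀

      p∣pᵅ : + p ∣ᶻ + (p ^ α)
      p∣pᵅ = ∣ᵤ⇒∣ (subst (λ n → p ℕ.∣ p ^ n) (ℕ.m+[n∸m]≡n 1≤α) (ℕ.m∣m*n (p ^ (α ℕ.∸ 1))))

      p∤r : ¬ (p ℕ.∣ r)
      p∤r p∣r = uu (subst (+ p ∣ᶻ_) (sym division) (∣m∣n⇒∣m+n {m = + r} (∣ᵤ⇒∣ p∣r) (∣n⇒∣m*n q p∣pᵅ)))

      1≤r : 1 ≤ r
      1≤r = ℕ.n≢0⇒n>0 λ r≡0 → p∤r (subst (p ℕ.∣_) (sym r≡0) (p ∣0))

      coprime : Coprime r p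
      coprime (d∣r , d∣p) with prime⇒irreducible p-prime d∣p
      ... | inj₁ d≡1 = d≡1
      ... | inj₂ refl = contradiction d∣r p∤r

    ·-congˡ : ∀ {k l} v → + (p ^ α) ∣ᶻ k -ᶻ l → k · v ≈ l · v
    ·-congˡ {k} {l} (a , b) d =
      subst (+ (p ^ α) ∣ᶻ_) (eq k l a) (∣m⇒∣m*n a d) ,
      subst (+ (p ^ β) ∣ᶻ_) (eq k l b) (∣m⇒∣m*n b (∣-trans pᵝ∣pᵅ d))
      where
      eq : ∀ k l a → (k -ᶻ l) * a ≡ k * a -ᶻ l * a
      eq = solve-∀

    -- Stated for arbitrary `v` so that the induction goes through. Replacing a coefficient by its
    -- residue changes the sum only up to `≈`.
    unitComb⇒weighted : ∀ {n S v} → UnitComb n S v →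
      ∃[ T ] T ⊆ S × length T ≡ n ×
      Σ[ u ∈ Vector ℕ (length T) ] (∀ i → Weights p α (u i)) × sum (λ i → u i ×ᴳ lookup T i) ≈ v
    unitComb⇒weighted [] = [] , [] , refl , (λ ()) , (λ ()) , ≈-refl {ε}
    unitComb⇒weighted (skip {x = x} c) with unitComb⇒weighted c
    ... | T , T⊆S , len , weighted = T , x ∷ʳ T⊆S , len , weighted
    unitComb⇒weighted (take {x = x} {v = v} k uk c) with unitComb⇒weighted c | weight uk
    ... | T , T⊆S , len , u , u∈A , Σ≈v | r , r∈A , r≡k =
      x ∷ T , refl ∷ T⊆S , cong suc len , r Vec.∷ u ,
      (λ { zero → r∈A ; (suc i) → u∈A i }) ,
      ∙-cong {r ×ᴳ x} {k · x} {sum (λ i → u i ×ᴳ lookup T i)} {v}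
        (subst (_≈ k · x) (sym (×ᴳ≡· r x)) (·-congˡ {+ r} {k} x r≡k)) Σ≈v

    hasOrderIn⇒hasOrder : ∀ {j v} → HasOrderIn kernel j v → HasOrder v (p ^ suc j)
    hasOrderIn⇒hasOrder {j} {v} (m , ¬m) =
      ℕ.m^n>0 p ⦃ prime⇒nonZero p-prime ⦄ (suc j) ,
      subst (_≈ ε) (sym (×ᴳ≡· (p ^ suc j) v)) (mem⇒≈ε {+ (p ^ suc j) · v} m) ,
      λ k 0<k kv≈ε → ℕ.∣⇒≤ ⦃ ℕ.>-nonZero 0<k ⦄
        (∣⇒∣ᵤ (order-∣ kernel j {+ k} {v} (subst Mem (×ᴳ≡· k v) (≈ε⇒mem {k ×ᴳ v} kv≈ε)) ¬m))

    hasOrder-unique : ∀ {v m n} → HasOrder v m → HasOrder v n → m ≡ n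
    hasOrder-unique (0<m , mv , min) (0<n , nv , min′) =
      ℕ.≤-antisym (min _ 0<n nv) (min′ _ 0<m mv)

    pᵅ·-mem : ∀ v → Mem (+ (p ^ α) · v)
    pᵅ·-mem (a , b) = ∣m⇒∣m*n a (divides 1ℤ (sym (ℤ.*-identityˡ _))) , ∣m⇒∣m*n b pᵝ∣pᵅ

    -- Conclusions for a sequence without weighted zero-sums.

    module _ (S : SequenceOver G) (len : length S ≡ α + β)
      (zsf : ∀ n → 1 ≤ n → n ≤ p ^ α → ¬ HasWeightedZeroSumSubsequence (Weights p α) S n) where

      independent : Independent kernel S
      independent {n} {v} c m with unitComb⇒weighted c
      ... | T , T⊆S , lenT , u , u∈A , Σ≈v =
        zsf (suc n) (s≤s z≤n) short
          (T , T⊆S , lenT , u , u∈A ,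
            ≈-trans {sum (λ i → u i ×ᴳ lookup T i)} {v} {ε} Σ≈v (mem⇒≈ε {v} m))
        where
        short : suc n ≤ p ^ α
        short = begin
          suc n     ≡⟨ lenT ⟨
          length T  ≤⟨ length-mono-≤ T⊆S ⟩
          length S  ≡⟨ len ⟩
          α + β     ≤⟨ ℕ.+-monoʳ-≤ α β≤α ⟩
          α + α     ≤⟨ +-double≤^ α ⟩
          p ^ α     ∎
          where open ℕ.≤-Reasoning

      δ-positive : ∀ j → 1 ≤ j → j ≤ α → 1 ≤ δ p α β j S
      δ-positive (suc j) _ j<α
        -- The two displayed vectors of the kernel have determinant p^(α+β), so `S` attains the
        -- length bound; `(1ℤ , 0ℤ)` has order p^α and survives `p ^ j` for j < α.
        with proj₂ (filtered (α + β) kernel {+ (p ^ α) , 0ℤ} {0ℤ , + (p ^ β)} {1ℤ}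
                     (divides 1ℤ (sym (ℤ.*-identityˡ _)) , divides 0ℤ refl)
                     (divides 0ℤ refl , divides 1ℤ (sym (ℤ.*-identityˡ _)))
                     unit-1 det≡ independent)
               len j (1ℤ , 0ℤ) large
        where
        det≡ : + (p ^ α) * + (p ^ β) -ᶻ 0ℤ * 0ℤ ≡ 1ℤ * + (p ^ (α + β))
        det≡ = trans (ℤ.+-identityʳ _) (trans (sym (ℤ.pos-* (p ^ α) (p ^ β)))
          (trans (cong +_ (sym (ℕ.^-distribˡ-+-* p α β))) (sym (ℤ.*-identityˡ _))))
        large : ¬ Mem (+ (p ^ j) · (1ℤ , 0ℤ))
        large (d , _) = ℕ.<⇒≱ (ℕ.^-monoʳ-< p 2≤p j<α)
          (ℕ.∣⇒≤ ⦃ ℕ.m^n≢0 p j ⦃ prime⇒nonZero p-prime ⦄ ⦄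
            (∣⇒∣ᵤ (subst (+ (p ^ α) ∣ᶻ_) (ℤ.*-identityʳ (+ (p ^ j))) d)))
      ... | x , x∈S , ord = ∈-length (∈-filter⁺ (λ y → hasOrder? _≈?_ y (p ^ suc j)) x∈S (hasOrderIn⇒hasOrder {j} {x} ord))

      -- Each term is nonzero by independence and is killed by `p ^ α`, so its order is `p ^ suc j`
      -- for exactly one `j` in `upTo α`.
      Σδ≡length : Σ[1≤j≤ α ] (λ j → δ p α β j S) ≡ α + β
      Σδ≡length = trans
        (sum-length-filter (λ j x → hasOrder? _≈?_ x (p ^ suc j)) (upTo⁺ α) (All.tabulate order))
        len
        where
        order : ∀ {x} → x ∈ S → ∃[ j ] j ∈ upTo α × HasOrder x (p ^ suc j) ×
                (∀ {i} → HasOrder x (p ^ suc i) → i ≡ j)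
        order {x} x∈S with order-exists kernel α {x} (pᵅ·-mem x) (independent-∈ kernel independent x∈S)
        ... | j , j<α , ordᴷ = j , ∈-upTo⁺ j<α , ord , λ {i} ord′ →
          ℕ.suc-injective (^-injective (hasOrder-unique {x} ord′ ord))
          where ord = hasOrderIn⇒hasOrder {j} {x} ordᴷ

theorem6p3 : (p : ℕ) → Prime p → 2 ∤ p →
    (α β : ℕ) → 1 ≤ α → 1 ≤ β → β ≤ α →
    (S : SequenceOver (ℤ/ (p ^ α) ⊕ℤ/ (p ^ β))) → length S ≡ α + β →
    (∀ n → 1 ≤ n → n ≤ p ^ α → ¬ Sequences.HasWeightedZeroSumSubsequence (ℤ/ (p ^ α) ⊕ℤ/ (p ^ β)) (Weights p α) S n) →
    (∀ j → 1 ≤ j → j ≤ α → 1 ≤ δ p α β j S) ×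
    (Σ[1≤j≤ α ] (λ j → δ p α β j S) ≡ α + β)
theorem6p3 p p-prime _ α β 1≤α _ β≤α S len zsf =
  δ-positive α β 1≤α β≤α S len zsf , Σδ≡length α β 1≤α β≤α S len zsf
  where open PrimePlane p p-prime
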